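{- There is an absolute constant $c>0$ such that for every $\epsilon>0$ and every positive integer $n$: if a tournament $T$ on $n$ vertices is $\epsilon$-far from being transitive, then it contains at least $c\epsilon^2 n^3$ directed triangles.
   Context: A tournament is a directed graph obtained by choosing a direction for each edge of an undirected complete graph. A tournament is transitive if there is a linear ordering of its vertices such that all edges point in one direction. A tournament on $n$ vertices is $\epsilon$-far from being transitive if the direction of at least $\epsilon n^2$ edges needs to be changed to obtain a transitive tournament. A directed triangle is a set of three vertices whose edges form a directed cycle of length $3$. -}

module Defs where

open import Data.Fin.Base as Fin using (Fin)
import Data.Fin.Properties as Fin
import Data.Integer.Base as ℤ
open import Data.List.Base using (allFin; cartesianProduct; filter; length)
open import Data.Nat.Base as ℕ using (ℕ)
import Data.Nat.Properties as ℕ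
open import Data.Product.Base using (∃; _×_; _,_; proj₁; proj₂)
open import Data.Rational.Base as ℚ using (ℚ; 0ℚ; 1ℚ; ∣_∣)
import Data.Rational.Properties as ℚ
open import Data.Rational.Solver using (module +-*-Solver)
open import Data.Sum.Base using (_⊎_)
open import Level using (0ℓ)
open import Relation.Binary.Consequences using (tri⇒dec<)
open import Relation.Binary.Core using (Rel; _⇒_)
open import Relation.Binary.Definitions using (Trichotomous; Decidable)
open import Relation.Binary.PropositionalEquality
  using (_≡_; refl; sym; trans; cong; cong₂; subst)
open import Relation.Binary.Structures using (IsStrictTotalOrder)
open import Relation.Nullary.Decidable using (_×-dec_; _⊎-dec_)
import Relation.Unary as U

-- Real numbers, as Cauchy sequences of rationals.  Two sequences denote
-- the same real when each is ≤ the other; no quotient is taken.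

IsCauchy : (ℕ → ℚ) → Set
IsCauchy x = ∀ δ → 0ℚ ℚ.< δ →
  ∃ λ N → ∀ m n → N ℕ.≤ m → N ℕ.≤ n → ∣ x m ℚ.- x n ∣ ℚ.< δ

record ℝ : Set where
  constructor mkℝ
  field
    seq    : ℕ → ℚ
    cauchy : IsCauchy seq

open ℝ public

infix  4 _≤_ _<_ _≥_
infixl 7 _*_

_≤_ : Rel ℝ 0ℓ
x ≤ y = ∀ δ → 0ℚ ℚ.< δ →
  ∃ λ N → ∀ n → N ℕ.≤ n → seq x n ℚ.≤ seq y n ℚ.+ δ

_<_ : Rel ℝ 0ℓ
x < y = ∃ λ δ → 0ℚ ℚ.< δ ×
  ∃ λ N → ∀ n → N ℕ.≤ n → seq x n ℚ.+ δ ℚ.≤ seq y n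

_≥_ : Rel ℝ 0ℓ
x ≥ y = y ≤ x

fromℚ : ℚ → ℝ
fromℚ q = mkℝ (λ _ → q) λ δ 0<δ →
  0 , λ _ _ _ _ → subst (ℚ._< δ) (sym (cong ∣_∣ (ℚ.+-inverseʳ q))) 0<δ

fromℕ : ℕ → ℝ
fromℕ k = fromℚ (ℤ.+ k ℚ./ 1)

0ℝ : ℝ
0ℝ = fromℕ 0

private
  eventually-bounded : ∀ (x : ℝ) → ∃ λ B → 0ℚ ℚ.< B ×
    ∃ λ N → ∀ n → N ℕ.≤ n → ∣ seq x n ∣ ℚ.< B
  eventually-bounded (mkℝ x cx) =
    ∣ x N ∣ ℚ.+ 1ℚ ,
    ℚ.<-≤-trans (ℚ.positive⁻¹ 1ℚ)
      (subst (ℚ._≤ ∣ x N ∣ ℚ.+ 1ℚ) (ℚ.+-identityˡ 1ℚ)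
        (ℚ.+-monoˡ-≤ 1ℚ (ℚ.0≤∣p∣ (x N)))) ,
    N , bound
    where
    N = proj₁ (cx 1ℚ (ℚ.positive⁻¹ 1ℚ))

    split : ∀ a b → b ℚ.+ (a ℚ.- b) ≡ a
    split = solve 2 (λ a b → b :+ (a :- b) := a) refl
      where open +-*-Solver

    bound : ∀ n → N ℕ.≤ n → ∣ x n ∣ ℚ.< ∣ x N ∣ ℚ.+ 1ℚ
    bound n N≤n = begin-strict
      ∣ x n ∣                      ≡⟨ cong ∣_∣ (split (x n) (x N)) ⟨
      ∣ x N ℚ.+ (x n ℚ.- x N) ∣    ≤⟨ ℚ.∣p+q∣≤∣p∣+∣q∣ (x N) (x n ℚ.- x N) ⟩
      ∣ x N ∣ ℚ.+ ∣ x n ℚ.- x N ∣  <⟨ ℚ.+-monoʳ-< ∣ x N ∣ close ⟩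
      ∣ x N ∣ ℚ.+ 1ℚ               ∎
      where
      open ℚ.≤-Reasoning
      close = proj₂ (cx 1ℚ (ℚ.positive⁻¹ 1ℚ)) n N N≤n ℕ.≤-refl

  product-diff : ∀ a b c d →
    a ℚ.* b ℚ.- c ℚ.* d ≡ a ℚ.* (b ℚ.- d) ℚ.+ (a ℚ.- c) ℚ.* d
  product-diff = solve 4 (λ a b c d →
    a :* b :- c :* d := a :* (b :- d) :+ (a :- c) :* d) refl
    where open +-*-Solver

  divide : ∀ δ A B → 0ℚ ℚ.< δ → 0ℚ ℚ.< A → 0ℚ ℚ.< B →
    ∃ λ η → 0ℚ ℚ.< η × A ℚ.* η ℚ.+ η ℚ.* B ≡ δ
  divide δ A B 0<δ 0<A 0<B = δ ℚ.* i , 0<η , total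
    where
    S = A ℚ.+ B
    S>0 = ℚ.pos+pos⇒pos A {{ℚ.positive 0<A}} B {{ℚ.positive 0<B}}
    S≢0 = ℚ.pos⇒nonZero S {{S>0}}
    i = ℚ.1/_ S {{S≢0}}
    0<η = ℚ.positive⁻¹ (δ ℚ.* i)
      {{ℚ.pos*pos⇒pos δ {{ℚ.positive 0<δ}} i {{ℚ.1/pos⇒pos S {{S>0}}}}}}

    collect : ∀ a b d j → a ℚ.* (d ℚ.* j) ℚ.+ (d ℚ.* j) ℚ.* b ≡ d ℚ.* ((a ℚ.+ b) ℚ.* j)
    collect = solve 4 (λ a b d j →
      a :* (d :* j) :+ (d :* j) :* b := d :* ((a :+ b) :* j)) refl
      where open +-*-Solver

    total = trans (collect A B δ i)
      (trans (cong (δ ℚ.*_) (ℚ.*-inverseʳ S {{S≢0}})) (ℚ.*-identityʳ δ))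

  product-< : ∀ p q {C D} → 0ℚ ℚ.< D →
    ∣ p ∣ ℚ.< C → ∣ q ∣ ℚ.< D → ∣ p ℚ.* q ∣ ℚ.< C ℚ.* D
  product-< p q {C} {D} 0<D p<C q<D = begin-strict
    ∣ p ℚ.* q ∣      ≡⟨ ℚ.∣p*q∣≡∣p∣*∣q∣ p q ⟩
    ∣ p ∣ ℚ.* ∣ q ∣  ≤⟨ ℚ.*-monoˡ-≤-nonNeg ∣ p ∣ {{ℚ.∣-∣-nonNeg p}} (ℚ.<⇒≤ q<D) ⟩
    ∣ p ∣ ℚ.* D      <⟨ ℚ.*-monoˡ-<-pos D {{ℚ.positive 0<D}} p<C ⟩
    C ℚ.* D          ∎
    where open ℚ.≤-Reasoning

  *-cauchy : ∀ (x y : ℝ) → IsCauchy (λ n → seq x n ℚ.* seq y n)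
  *-cauchy X@(mkℝ x cx) Y@(mkℝ y cy) δ 0<δ =
    let A , 0<A , Na , bx = eventually-bounded X
        B , 0<B , Nb , by = eventually-bounded Y
        η , 0<η , total   = divide δ A B 0<δ 0<A 0<B
    in combine A Na bx B 0<B Nb by η 0<η total
    where
    combine : ∀ A Na → (∀ n → Na ℕ.≤ n → ∣ x n ∣ ℚ.< A) →
              ∀ B → 0ℚ ℚ.< B → ∀ Nb → (∀ n → Nb ℕ.≤ n → ∣ y n ∣ ℚ.< B) →
              ∀ η → 0ℚ ℚ.< η → A ℚ.* η ℚ.+ η ℚ.* B ≡ δ →
              ∃ λ N → ∀ m n → N ℕ.≤ m → N ℕ.≤ n →
                ∣ x m ℚ.* y m ℚ.- x n ℚ.* y n ∣ ℚ.< δ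
    combine A Na bx B 0<B Nb by η 0<η total = N , close
      where
      Nx = proj₁ (cx η 0<η)
      Ny = proj₁ (cy η 0<η)
      N  = (Na ℕ.⊔ Nb) ℕ.⊔ (Nx ℕ.⊔ Ny)

      Na≤ : Na ℕ.≤ N
      Na≤ = ℕ.≤-trans (ℕ.m≤m⊔n Na Nb) (ℕ.m≤m⊔n _ _)
      Nb≤ : Nb ℕ.≤ N
      Nb≤ = ℕ.≤-trans (ℕ.m≤n⊔m Na Nb) (ℕ.m≤m⊔n _ _)
      Nx≤ : Nx ℕ.≤ N
      Nx≤ = ℕ.≤-trans (ℕ.m≤m⊔n Nx Ny) (ℕ.m≤n⊔m (Na ℕ.⊔ Nb) _)
      Ny≤ : Ny ℕ.≤ N
      Ny≤ = ℕ.≤-trans (ℕ.m≤n⊔m Nx Ny) (ℕ.m≤n⊔m (Na ℕ.⊔ Nb) _)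

      close : ∀ m n → N ℕ.≤ m → N ℕ.≤ n → ∣ x m ℚ.* y m ℚ.- x n ℚ.* y n ∣ ℚ.< δ
      close m n N≤m N≤n = begin-strict
        ∣ x m ℚ.* y m ℚ.- x n ℚ.* y n ∣
          ≡⟨ cong ∣_∣ (product-diff (x m) (y m) (x n) (y n)) ⟩
        ∣ x m ℚ.* (y m ℚ.- y n) ℚ.+ (x m ℚ.- x n) ℚ.* y n ∣
          ≤⟨ ℚ.∣p+q∣≤∣p∣+∣q∣ (x m ℚ.* (y m ℚ.- y n)) ((x m ℚ.- x n) ℚ.* y n) ⟩
        ∣ x m ℚ.* (y m ℚ.- y n) ∣ ℚ.+ ∣ (x m ℚ.- x n) ℚ.* y n ∣
          <⟨ ℚ.+-mono-<
               (product-< (x m) (y m ℚ.- y n) 0<η (bx m (ℕ.≤-trans Na≤ N≤m))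
                 (proj₂ (cy η 0<η) m n (ℕ.≤-trans Ny≤ N≤m) (ℕ.≤-trans Ny≤ N≤n)))
               (product-< (x m ℚ.- x n) (y n) 0<B
                 (proj₂ (cx η 0<η) m n (ℕ.≤-trans Nx≤ N≤m) (ℕ.≤-trans Nx≤ N≤n))
                 (by n (ℕ.≤-trans Nb≤ N≤n))) ⟩
        A ℚ.* η ℚ.+ η ℚ.* B
          ≡⟨ total ⟩
        δ ∎
        where open ℚ.≤-Reasoning

_*_ : ℝ → ℝ → ℝ
x * y = mkℝ (λ n → seq x n ℚ.* seq y n) (*-cauchy x y)

-- Trichotomy says that for u ≢ v exactly one of u ⟶ v and v ⟶ u holds,
-- and that there are no loops.
record Tournament (n : ℕ) : Set₁ where
  infix 4 _⟶_ _⟶?_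
  field
    _⟶_     : Rel (Fin n) 0ℓ
    compare : Trichotomous _≡_ _⟶_

  _⟶?_ : Decidable _⟶_
  _⟶?_ = tri⇒dec< compare

IsTransitive : ∀ {n} → Tournament n → Set₁
IsTransitive {n} T = ∃ λ (_≺_ : Rel (Fin n) 0ℓ) →
  IsStrictTotalOrder _≡_ _≺_ × (_⟶_ ⇒ _≺_)
  where open Tournament T

module _ {n : ℕ} where

  -- Each edge of T is the ordered pair (u , v) with u ⟶ v in T, so an edge
  -- directed differently in T′ is counted exactly once.
  Reversed : (T T′ : Tournament n) → U.Pred (Fin n × Fin n) 0ℓ
  Reversed T T′ (u , v) = (u T.⟶ v) × (v T′.⟶ u)
    where module T = Tournament T
          module T′ = Tournament T′

  reversed? : (T T′ : Tournament n) → U.Decidable (Reversed T T′)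
  reversed? T T′ (u , v) = (u T.⟶? v) ×-dec (v T′.⟶? u)
    where module T = Tournament T
          module T′ = Tournament T′

  reversals : (T T′ : Tournament n) → ℕ
  reversals T T′ =
    length (filter (reversed? T T′) (cartesianProduct (allFin n) (allFin n)))

  FarFromTransitive : ℝ → Tournament n → Set₁
  FarFromTransitive ε T = ∀ T′ → IsTransitive T′ →
    fromℕ (reversals T T′) ≥ ε * fromℕ (n ℕ.^ 2)

  module _ (T : Tournament n) where
    open Tournament T

    -- A set of three vertices is listed once, in increasing order; its
    -- edges form a directed cycle in one of the two possible orientations.
    DirectedTriangle : U.Pred (Fin n × Fin n × Fin n) 0ℓ
    DirectedTriangle (u , v , w) =
      (u Fin.< v × v Fin.< w) ×
      ((u ⟶ v × v ⟶ w × w ⟶ u) ⊎ (u ⟶ w × w ⟶ v × v ⟶ u))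

    directedTriangle? : U.Decidable DirectedTriangle
    directedTriangle? (u , v , w) =
      ((u Fin.<? v) ×-dec (v Fin.<? w)) ×-dec
      (((u ⟶? v) ×-dec (v ⟶? w) ×-dec (w ⟶? u)) ⊎-dec
       ((u ⟶? w) ×-dec (w ⟶? v) ×-dec (v ⟶? u)))

    directedTriangles : ℕ
    directedTriangles = length (filter directedTriangle?
      (cartesianProduct (allFin n) (cartesianProduct (allFin n) (allFin n))))

{-# OPTIONS --safe #-}

-- Order the vertices by decreasing outdegree d.  Fix u and let S be the set
-- of the b vertices v with u ⟶ v and d u ≤ d v, so that only edges from u
-- into S are reversed.  A vertex v of S has at least d u out-neighbours; by
-- counting those of them that lie in S, respectively in N⁺(u) ∖ S, one finds
-- that the number of directed triangles u ⟶ v ⟶ w ⟶ u with v in S is at least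
-- b · d u − b ² / 2 − b · (d u − b) = b ² / 2.  Summing over u bounds Σ b ² by
-- a multiple of the number of directed triangles, and Cauchy–Schwarz bounds
-- the square of the number Σ b of reversals by n Σ b ².
module Submission where

open import Defs
open import Data.Nat.Base as ℕ using (ℕ)
open import Data.Product.Base using (∃; _×_)

open import Data.Bool.Base using (true; false; if_then_else_)
open import Data.Fin.Base as Fin using (Fin; zero; suc)
import Data.Fin.Properties as Fin
import Data.Integer.Base as ℤ
import Data.Integer.Properties as ℤ
open import Data.List.Base
  using ([]; _∷_; _++_; map; filter; length; cartesianProduct; tabulate; allFin)
import Data.List.Properties as List hiding (sum-++)
import Data.Nat.ListAction as List
import Data.Nat.ListAction.Properties as List
import Data.Nat.Properties as ℕ
open import Data.Nat.Solver using () renaming (module +-*-Solver to ℕ-Solver)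
open import Data.Product.Base using (_,_; proj₁; proj₂)
open import Data.Product.Relation.Binary.Lex.Strict using (×-Lex; ×-isStrictTotalOrder)
open import Data.Rational.Base as ℚ using (ℚ; 0ℚ; 1ℚ)
import Data.Rational.Properties as ℚ
open import Data.Rational.Solver using () renaming (module +-*-Solver to ℚ-Solver)
import Data.Rational.Unnormalised.Base as ℚᵘ
import Data.Rational.Unnormalised.Properties as ℚᵘ
open import Data.Sum.Base using (_⊎_; inj₁; inj₂)
open import Function.Base using (_∘_; _on_; flip)
open import Level using (0ℓ)
open import Relation.Binary.Core using (Rel)
open import Relation.Binary.Definitions using (tri<; tri≈; tri>)
import Relation.Binary.Construct.Flip.EqAndOrd as Flip
open import Relation.Binary.PropositionalEquality
open import Relation.Binary.Structures using (IsStrictTotalOrder)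
open import Relation.Nullary.Decidable using (Dec; yes; no; does; _×-dec_)
open import Relation.Nullary.Negation using (¬_; contradiction)
import Relation.Unary as U

open import Algebra.Properties.Semiring.Sum ℕ.+-*-semiring
  using (sum; sum-syntax; sum-cong-≗; ∑-comm; ∑-distrib-+; *-distribˡ-sum; *-distribʳ-sum)

-- Finite sums

sum-mono : ∀ {n} {f g : Fin n → ℕ} → (∀ i → f i ℕ.≤ g i) → sum f ℕ.≤ sum g
sum-mono {ℕ.zero}  f≤g = ℕ.z≤n
sum-mono {ℕ.suc n} f≤g = ℕ.+-mono-≤ (f≤g zero) (sum-mono (f≤g ∘ suc))

sum-const : ∀ n k → ∑[ i < n ] k ≡ n ℕ.* k
sum-const ℕ.zero    k = refl
sum-const (ℕ.suc n) k = cong (k ℕ.+_) (sum-const n k)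

module _ {n : ℕ} where

  ∑² : (Fin n → Fin n → ℕ) → ℕ
  ∑² f = ∑[ u < n ] ∑[ v < n ] f u v

  ∑²-mono : ∀ {f g} → (∀ u v → f u v ℕ.≤ g u v) → ∑² f ℕ.≤ ∑² g
  ∑²-mono f≤g = sum-mono (λ u → sum-mono (f≤g u))

  ∑²-distrib-+ : ∀ f g → ∑² (λ u v → f u v ℕ.+ g u v) ≡ ∑² f ℕ.+ ∑² g
  ∑²-distrib-+ f g = trans (sum-cong-≗ (λ u → ∑-distrib-+ (f u) (g u)))
                           (∑-distrib-+ (sum ∘ f) (sum ∘ g))

  ∑²-* : ∀ (f g : Fin n → ℕ) → ∑² (λ u v → f u ℕ.* g v) ≡ sum f ℕ.* sum g
  ∑²-* f g = trans (sum-cong-≗ (λ u → sym (*-distribˡ-sum (f u) g)))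
                   (sym (*-distribʳ-sum (sum g) f))

  ∑³ : (Fin n → Fin n → Fin n → ℕ) → ℕ
  ∑³ f = ∑[ u < n ] ∑² (f u)

  ∑³-mono : ∀ {f g} → (∀ u v w → f u v w ℕ.≤ g u v w) → ∑³ f ℕ.≤ ∑³ g
  ∑³-mono f≤g = sum-mono (λ u → ∑²-mono (f≤g u))

  ∑³-distrib-+ : ∀ f g → ∑³ (λ u v w → f u v w ℕ.+ g u v w) ≡ ∑³ f ℕ.+ ∑³ g
  ∑³-distrib-+ f g = trans (sum-cong-≗ (λ u → ∑²-distrib-+ (f u) (g u)))
                           (∑-distrib-+ (∑² ∘ f) (∑² ∘ g))

  ∑³-comm₁₂ : ∀ f → ∑³ f ≡ ∑³ (λ u v w → f v u w)
  ∑³-comm₁₂ f = ∑-comm (λ u v → sum (f u v))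

  ∑³-comm₂₃ : ∀ f → ∑³ f ≡ ∑³ (λ u v w → f u w v)
  ∑³-comm₂₃ f = sum-cong-≗ (λ u → ∑-comm (f u))

-- Simultaneous induction stands in for (m - n)² ≥ 0, which truncated subtraction would obscure:
-- passing to both successors adds 2 + 2m + 2n to each side.
2mn≤m²+n² : ∀ m n → 2 ℕ.* (m ℕ.* n) ℕ.≤ m ℕ.* m ℕ.+ n ℕ.* n
2mn≤m²+n² ℕ.zero    n         = ℕ.z≤n
2mn≤m²+n² (ℕ.suc m) ℕ.zero    rewrite ℕ.*-zeroʳ m = ℕ.z≤n
2mn≤m²+n² (ℕ.suc m) (ℕ.suc n) = begin
  2 ℕ.* (ℕ.suc m ℕ.* ℕ.suc n)                       ≡⟨ expand₁ m n ⟩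
  2 ℕ.* (m ℕ.* n) ℕ.+ (2 ℕ.+ 2 ℕ.* m ℕ.+ 2 ℕ.* n)   ≤⟨ ℕ.+-monoˡ-≤ _ (2mn≤m²+n² m n) ⟩
  m ℕ.* m ℕ.+ n ℕ.* n ℕ.+ (2 ℕ.+ 2 ℕ.* m ℕ.+ 2 ℕ.* n) ≡⟨ expand₂ m n ⟩
  ℕ.suc m ℕ.* ℕ.suc m ℕ.+ ℕ.suc n ℕ.* ℕ.suc n       ∎
  where
  open ℕ.≤-Reasoning
  open ℕ-Solver
  expand₁ : ∀ m n → 2 ℕ.* (ℕ.suc m ℕ.* ℕ.suc n) ≡
                    2 ℕ.* (m ℕ.* n) ℕ.+ (2 ℕ.+ 2 ℕ.* m ℕ.+ 2 ℕ.* n)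
  expand₁ = solve 2 (λ m n → con 2 :* ((con 1 :+ m) :* (con 1 :+ n)) :=
    con 2 :* (m :* n) :+ (con 2 :+ con 2 :* m :+ con 2 :* n)) refl
  expand₂ : ∀ m n → m ℕ.* m ℕ.+ n ℕ.* n ℕ.+ (2 ℕ.+ 2 ℕ.* m ℕ.+ 2 ℕ.* n) ≡
                    ℕ.suc m ℕ.* ℕ.suc m ℕ.+ ℕ.suc n ℕ.* ℕ.suc n
  expand₂ = solve 2 (λ m n → m :* m :+ n :* n :+ (con 2 :+ con 2 :* m :+ con 2 :* n) :=
    (con 1 :+ m) :* (con 1 :+ m) :+ (con 1 :+ n) :* (con 1 :+ n)) refl

-- Sum the inequality 2 `f u` `f v` ≤ `f u`² + `f v`² over all ordered pairs; each square on the
-- right is then counted `n` times in each of the two terms.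
cauchy-schwarz : ∀ {n} (f : Fin n → ℕ) →
  sum f ℕ.* sum f ℕ.≤ n ℕ.* ∑[ u < n ] (f u ℕ.* f u)
cauchy-schwarz {n} f = ℕ.*-cancelˡ-≤ 2 (begin
  2 ℕ.* (sum f ℕ.* sum f)                        ≡⟨ cong (2 ℕ.*_) (∑²-* f f) ⟨
  2 ℕ.* ∑² (λ u v → f u ℕ.* f v)                 ≡⟨ *-distribˡ-sum 2 (λ u → ∑[ v < n ] (f u ℕ.* f v)) ⟩
  (∑[ u < n ] (2 ℕ.* ∑[ v < n ] (f u ℕ.* f v)))  ≡⟨ sum-cong-≗ (λ u → *-distribˡ-sum 2 (λ v → f u ℕ.* f v)) ⟩
  ∑² (λ u v → 2 ℕ.* (f u ℕ.* f v))               ≤⟨ ∑²-mono (λ u v → 2mn≤m²+n² (f u) (f v)) ⟩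
  ∑² (λ u v → f u ℕ.* f u ℕ.+ f v ℕ.* f v)       ≡⟨ ∑²-distrib-+ (λ u v → f u ℕ.* f u) (λ u v → f v ℕ.* f v) ⟩
  ∑² (λ u v → f u ℕ.* f u) ℕ.+ ∑² (λ u v → f v ℕ.* f v)
    -- Once the summations are exchanged, both double sums are constant in the outer index.
    ≡⟨ cong (ℕ._+ ∑² (λ u v → f v ℕ.* f v)) (∑-comm {n} {n} (λ u v → f u ℕ.* f u)) ⟩
  ∑² (λ u v → f v ℕ.* f v) ℕ.+ ∑² (λ u v → f v ℕ.* f v)
    ≡⟨ cong₂ ℕ._+_ (sum-const n _) (trans (sum-const n _) (sym (ℕ.+-identityʳ _))) ⟩
  2 ℕ.* (n ℕ.* ∑[ u < n ] (f u ℕ.* f u))         ∎)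
  where open ℕ.≤-Reasoning

-- Counting

𝟙 : ∀ {p} {P : Set p} → Dec P → ℕ
𝟙 P? = if does P? then 1 else 0

1≤𝟙 : ∀ {p} {P : Set p} (P? : Dec P) → P → 1 ℕ.≤ 𝟙 P?
1≤𝟙 (yes _) _ = ℕ.≤-refl
1≤𝟙 (no ¬p) p = contradiction p ¬p

𝟙-≤ : ∀ {p} {P : Set p} (P? : Dec P) {m} → (P → 1 ℕ.≤ m) → 𝟙 P? ℕ.≤ m
𝟙-≤ (yes p) 1≤m = 1≤m p
𝟙-≤ (no _)  _   = ℕ.z≤n

𝟙-*-≤ : ∀ {p} {P : Set p} (P? : Dec P) {k m} → (P → k ℕ.≤ m) → 𝟙 P? ℕ.* k ℕ.≤ m
𝟙-*-≤ (yes p) {k} {m} k≤m = subst (ℕ._≤ m) (sym (ℕ.*-identityˡ k)) (k≤m p)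
𝟙-*-≤ (no _)  _           = ℕ.z≤n

𝟙-*-mono-≤ : ∀ {p} {P : Set p} (P? : Dec P) {k m} → (P → k ℕ.≤ m) →
  𝟙 P? ℕ.* k ℕ.≤ 𝟙 P? ℕ.* m
𝟙-*-mono-≤ (yes p) k≤m = ℕ.*-monoʳ-≤ 1 (k≤m p)
𝟙-*-mono-≤ (no _)  _   = ℕ.z≤n

-- Turns the list counts behind `reversals` and `directedTriangles` into sums of indicators, where
-- summations can be exchanged and compared termwise.
length-filter : ∀ {a p} {A : Set a} {P : U.Pred A p} (P? : U.Decidable P) xs →
  length (filter P? xs) ≡ List.sum (map (𝟙 ∘ P?) xs)
length-filter P? []       = refl
length-filter P? (x ∷ xs) with does (P? x)
... | true  = cong ℕ.suc (length-filter P? xs)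
... | false = length-filter P? xs

sum-map-cartesianProduct : ∀ {a b} {A : Set a} {B : Set b} (f : A × B → ℕ) xs ys →
  List.sum (map f (cartesianProduct xs ys)) ≡
  List.sum (map (λ x → List.sum (map (λ y → f (x , y)) ys)) xs)
sum-map-cartesianProduct f []       ys = refl
sum-map-cartesianProduct f (x ∷ xs) ys = begin
  List.sum (map f (map (x ,_) ys ++ cartesianProduct xs ys))
    ≡⟨ cong List.sum (List.map-++ f (map (x ,_) ys) _) ⟩
  List.sum (map f (map (x ,_) ys) ++ map f (cartesianProduct xs ys))
    ≡⟨ List.sum-++ (map f (map (x ,_) ys)) _ ⟩
  List.sum (map f (map (x ,_) ys)) ℕ.+ List.sum (map f (cartesianProduct xs ys))
    ≡⟨ cong₂ ℕ._+_ (cong List.sum (sym (List.map-∘ ys))) (sum-map-cartesianProduct f xs ys) ⟩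
  List.sum (map (λ y → f (x , y)) ys) ℕ.+
  List.sum (map (λ x → List.sum (map (λ y → f (x , y)) ys)) xs) ∎
  where open ≡-Reasoning

sum-tabulate : ∀ {n} (f : Fin n → ℕ) → List.sum (tabulate f) ≡ sum f
sum-tabulate {ℕ.zero}  f = refl
sum-tabulate {ℕ.suc n} f = cong (f zero ℕ.+_) (sum-tabulate (f ∘ suc))

sum-map-allFin : ∀ {n} (f : Fin n → ℕ) → List.sum (map f (allFin n)) ≡ sum f
sum-map-allFin f = trans (cong List.sum (List.map-tabulate (λ i → i) f)) (sum-tabulate f)

sum-map-pairs : ∀ {n} (f : Fin n × Fin n → ℕ) →
  List.sum (map f (cartesianProduct (allFin n) (allFin n))) ≡ ∑² (λ u v → f (u , v))
sum-map-pairs {n} f = trans (sum-map-cartesianProduct f (allFin n) (allFin n))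
  (trans (sum-map-allFin (λ u → List.sum (map (λ v → f (u , v)) (allFin n))))
         (sum-cong-≗ (λ u → sum-map-allFin (λ v → f (u , v)))))

sum-map-triples : ∀ {n} (f : Fin n × Fin n × Fin n → ℕ) →
  List.sum (map f (cartesianProduct (allFin n) (cartesianProduct (allFin n) (allFin n)))) ≡
  ∑³ (λ u v w → f (u , v , w))
sum-map-triples {n} f =
  trans (sum-map-cartesianProduct f (allFin n) pairs)
  (trans (sum-map-allFin (λ u → List.sum (map (λ p → f (u , p)) pairs)))
         (sum-cong-≗ (λ u → sum-map-pairs (λ p → f (u , p)))))
  where pairs = cartesianProduct (allFin n) (allFin n)

-- Directed triangles and reversed edges

module _ {n : ℕ} (T : Tournament n) where
  open Tournament T

  ⟶-irrefl : ∀ {u} → ¬ u ⟶ u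
  ⟶-irrefl {u} u⟶u with compare u u
  ... | tri< _ u≢u _ = u≢u refl
  ... | tri≈ u↛u _ _ = u↛u u⟶u
  ... | tri> _ u≢u _ = u≢u refl

  ⟶-asym : ∀ {u v} → u ⟶ v → ¬ v ⟶ u
  ⟶-asym {u} {v} u⟶v v⟶u with compare u v
  ... | tri< _ _ v↛u = v↛u v⟶u
  ... | tri≈ u↛v _ _ = u↛v u⟶v
  ... | tri> u↛v _ _ = u↛v u⟶v

  edge : Fin n → Fin n → ℕ
  edge u v = 𝟙 (u ⟶? v)

  outdegree : Fin n → ℕ
  outdegree u = ∑[ v < n ] edge u v

  Cyclic : Fin n → Fin n → Fin n → Set
  Cyclic u v w = u ⟶ v × v ⟶ w × w ⟶ u

  cyclic? : ∀ u v w → Dec (Cyclic u v w)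
  cyclic? u v w = (u ⟶? v) ×-dec (v ⟶? w) ×-dec (w ⟶? u)

  private
    triangle : Fin n → Fin n → Fin n → ℕ
    triangle u v w = 𝟙 (directedTriangle? T (u , v , w))

    -- The vertices of a directed cycle are distinct, so one of their six arrangements is
    -- increasing. Even arrangements give the first orientation in `DirectedTriangle`, odd ones the
    -- second.
    cyclic≤triangles : ∀ u v w → 𝟙 (cyclic? u v w) ℕ.≤
      triangle u v w ℕ.+ (triangle u w v ℕ.+ (triangle v u w ℕ.+
      (triangle v w u ℕ.+ (triangle w u v ℕ.+ triangle w v u))))
    cyclic≤triangles u v w = 𝟙-≤ (cyclic? u v w) sorted
      where
      skip : ∀ k {m} → 1 ℕ.≤ m → 1 ℕ.≤ k ℕ.+ m
      skip k = ℕ.m≤n⇒m≤o+n k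
      here : ∀ {x y z k} → DirectedTriangle T (x , y , z) → 1 ℕ.≤ triangle x y z ℕ.+ k
      here {x} {y} {z} {k} t =
        ℕ.m≤n⇒m≤n+o k (1≤𝟙 (directedTriangle? T (x , y , z)) t)

      sorted : Cyclic u v w → 1 ℕ.≤
        triangle u v w ℕ.+ (triangle u w v ℕ.+ (triangle v u w ℕ.+
        (triangle v w u ℕ.+ (triangle w u v ℕ.+ triangle w v u))))
      sorted (uv , vw , wu) with Fin.<-cmp u v | Fin.<-cmp v w | Fin.<-cmp u w
      ... | tri≈ _ refl _ | _ | _ = contradiction uv ⟶-irrefl
      ... | _ | tri≈ _ refl _ | _ = contradiction vw ⟶-irrefl
      ... | _ | _ | tri≈ _ refl _ = contradiction wu ⟶-irrefl
      -- A wildcard stands where two comparisons already fix the order, so inconsistent combinations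
      -- need no clause of their own.
      ... | tri< u<v _ _ | tri< v<w _ _ | _ = here ((u<v , v<w) , inj₁ (uv , vw , wu))
      ... | tri< u<v _ _ | tri> _ _ w<v | tri< u<w _ _ =
        skip (triangle u v w) (here ((u<w , w<v) , inj₂ (uv , vw , wu)))
      ... | tri> _ _ v<u | _ | tri< u<w _ _ =
        skip (triangle u v w) (skip (triangle u w v)
          (here ((v<u , u<w) , inj₂ (vw , wu , uv))))
      ... | tri> _ _ v<u | tri< v<w _ _ | tri> _ _ w<u =
        skip (triangle u v w) (skip (triangle u w v) (skip (triangle v u w)
          (here ((v<w , w<u) , inj₁ (vw , wu , uv)))))
      ... | tri< u<v _ _ | tri> _ _ w<v | tri> _ _ w<u =
        skip (triangle u v w) (skip (triangle u w v) (skip (triangle v u w)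
          (skip (triangle v w u) (here ((w<u , u<v) , inj₁ (wu , uv , vw))))))
      ... | tri> _ _ v<u | tri> _ _ w<v | tri> _ _ w<u =
        skip (triangle u v w) (skip (triangle u w v) (skip (triangle v u w)
          (skip (triangle v w u) (skip (triangle w u v)
            (1≤𝟙 (directedTriangle? T (w , v , u)) ((w<v , v<u) , inj₂ (wu , uv , vw)))))))

  -- The true value of the left-hand side is 3 * directedTriangles T.
  ∑-cyclic≤ : ∑³ (λ u v w → 𝟙 (cyclic? u v w)) ℕ.≤ 6 ℕ.* directedTriangles T
  ∑-cyclic≤ = begin
    ∑³ (λ u v w → 𝟙 (cyclic? u v w))
      ≤⟨ ∑³-mono cyclic≤triangles ⟩
    ∑³ (λ u v w → uvw u v w ℕ.+ (uwv u v w ℕ.+ (vuw u v w ℕ.+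
      (vwu u v w ℕ.+ (wuv u v w ℕ.+ wvu u v w)))))
      ≡⟨ +-step uvw (+-step uwv (+-step vuw (+-step vwu (∑³-distrib-+ wuv wvu)))) ⟩
    ∑³ uvw ℕ.+ (∑³ uwv ℕ.+ (∑³ vuw ℕ.+ (∑³ vwu ℕ.+ (∑³ wuv ℕ.+ ∑³ wvu))))
      ≡⟨ cong₂ ℕ._+_ uvw≡ (cong₂ ℕ._+_ uwv≡ (cong₂ ℕ._+_ vuw≡
           (cong₂ ℕ._+_ vwu≡ (cong₂ ℕ._+_ wuv≡ wvu≡)))) ⟩
    t ℕ.+ (t ℕ.+ (t ℕ.+ (t ℕ.+ (t ℕ.+ t))))
      ≡⟨ solve 1 (λ t → t :+ (t :+ (t :+ (t :+ (t :+ t)))) := con 6 :* t) refl t ⟩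
    6 ℕ.* t ∎
    where
    open ℕ.≤-Reasoning
    open ℕ-Solver
    t = directedTriangles T
    uvw uwv vuw vwu wuv wvu : Fin n → Fin n → Fin n → ℕ
    uvw = triangle
    uwv u v w = triangle u w v
    vuw u v w = triangle v u w
    vwu u v w = triangle v w u
    wuv u v w = triangle w u v
    wvu u v w = triangle w v u

    +-step : ∀ f {g k} → ∑³ g ≡ k → ∑³ (λ u v w → f u v w ℕ.+ g u v w) ≡ ∑³ f ℕ.+ k
    +-step f {g} eq = trans (∑³-distrib-+ f g) (cong (∑³ f ℕ.+_) eq)

    uvw≡ : ∑³ uvw ≡ t
    uvw≡ = sym (trans
      (length-filter (directedTriangle? T) (cartesianProduct (allFin n) (cartesianProduct (allFin n) (allFin n))))
      (sum-map-triples (𝟙 ∘ directedTriangle? T)))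
    -- Each further arrangement comes from an earlier one by exchanging two adjacent summations.
    uwv≡ = trans (sym (∑³-comm₂₃ uvw)) uvw≡
    vuw≡ = trans (sym (∑³-comm₁₂ uvw)) uvw≡
    vwu≡ = trans (sym (∑³-comm₁₂ uwv)) uwv≡
    wuv≡ = trans (sym (∑³-comm₂₃ vuw)) vuw≡
    wvu≡ = trans (sym (∑³-comm₂₃ vwu)) vwu≡

  -- Backward edges at a vertex

  -- Ties in outdegree are included, so that every edge reversed by an order of decreasing outdegree
  -- is covered, however ties are broken. For fixed `u` these `v` form the set S.
  Backward : Rel (Fin n) 0ℓ
  Backward u v = u ⟶ v × outdegree u ℕ.≤ outdegree v

  backward? : ∀ u v → Dec (Backward u v)
  backward? u v = (u ⟶? v) ×-dec (outdegree u ℕ.≤? outdegree v)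

  backdegree : Fin n → ℕ
  backdegree u = ∑[ v < n ] 𝟙 (backward? u v)

  private
    module _ (u : Fin n) where
      d = outdegree u
      b = backdegree u

      s : Fin n → ℕ
      s v = 𝟙 (backward? u v)

      -- `cycles` marks the directed triangles through `u` whose second vertex lies in S, and
      -- `inner` the edges with both ends in S.
      cycles inner : Fin n → Fin n → ℕ
      cycles v w = s v ℕ.* (edge v w ℕ.* edge w u)
      inner  v w = s v ℕ.* (edge v w ℕ.* s w)

      -- Read S as `v` ∈ S, A as `v ⟶ w`, B as `w ⟶ u`, S′ as `w` ∈ S and X as `u ⟶ w`. When S
      -- holds, the claim is S′ ≤ X if A fails and 1 ≤ B + X if A holds. Abstract decisions allow a
      -- plain case split.
      pointwise : ∀ {S A B S′ X : Set}
        (S? : Dec S) (A? : Dec A) (B? : Dec B) (S′? : Dec S′) (X? : Dec X) →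
        (S′ → X) → (S → A → B ⊎ X) →
        𝟙 S? ℕ.* 𝟙 A? ℕ.+ 𝟙 S? ℕ.* 𝟙 S′? ℕ.≤
        𝟙 S? ℕ.* (𝟙 A? ℕ.* 𝟙 B?) ℕ.+ 𝟙 S? ℕ.* (𝟙 A? ℕ.* 𝟙 S′?) ℕ.+ 𝟙 S? ℕ.* 𝟙 X?
      pointwise (no _)  _ _ _ _ _ _ = ℕ.z≤n
      pointwise (yes _) (no _)  _ (no _)   _        _ _ = ℕ.z≤n
      pointwise (yes _) (no _)  _ (yes _)  (yes _)  _ _ = ℕ.≤-refl
      pointwise (yes _) (no _)  _ (yes s′) (no ¬x)  f _ = contradiction (f s′) ¬x
      pointwise (yes _) (yes _) _       (yes s′) (no ¬x) f _ = contradiction (f s′) ¬x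
      pointwise (yes _) (yes _) (yes _) (yes _)  (yes _) _ _ = ℕ.m≤m+n 2 1
      pointwise (yes _) (yes _) (no _)  (yes _)  (yes _) _ _ = ℕ.≤-refl
      pointwise (yes _) (yes _) (yes _) (no _)   _       _ _ = ℕ.m≤m+n 1 _
      pointwise (yes _) (yes _) (no _)  (no _)   (yes _) _ _ = ℕ.≤-refl
      pointwise (yes s) (yes a) (no ¬b) (no _)   (no ¬x) _ g with g s a
      ... | inj₁ b = contradiction b ¬b
      ... | inj₂ x = contradiction x ¬x

      closes : ∀ {v w} → Backward u v → v ⟶ w → w ⟶ u ⊎ u ⟶ w
      closes {v} {w} (u⟶v , _) v⟶w with compare w u
      ... | tri< w⟶u _ _    = inj₁ w⟶u
      -- Here `w` = `u`, and `v ⟶ w` would be the opposite of the edge `u ⟶ v`.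
      ... | tri≈ _ refl _   = contradiction v⟶w (⟶-asym u⟶v)
      ... | tri> _ _ u⟶w    = inj₂ u⟶w

      one-orientation : ∀ {S A B S′ : Set}
        (S? : Dec S) (A? : Dec A) (B? : Dec B) (S′? : Dec S′) → (A → ¬ B) →
        𝟙 S? ℕ.* (𝟙 A? ℕ.* 𝟙 S′?) ℕ.+ 𝟙 S′? ℕ.* (𝟙 B? ℕ.* 𝟙 S?) ℕ.≤ 𝟙 S? ℕ.* 𝟙 S′?
      one-orientation (no _)  _       (no _)  (no _)  _ = ℕ.z≤n
      one-orientation (no _)  _       (no _)  (yes _) _ = ℕ.z≤n
      one-orientation (no _)  _       (yes _) (no _)  _ = ℕ.z≤n
      one-orientation (no _)  _       (yes _) (yes _) _ = ℕ.z≤n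
      one-orientation (yes _) (no _)  (no _)  (no _)  _ = ℕ.z≤n
      one-orientation (yes _) (no _)  (no _)  (yes _) _ = ℕ.z≤n
      one-orientation (yes _) (no _)  (yes _) (no _)  _ = ℕ.z≤n
      one-orientation (yes _) (no _)  (yes _) (yes _) _ = ℕ.≤-refl
      one-orientation (yes _) (yes _) (no _)  (no _)  _ = ℕ.z≤n
      one-orientation (yes _) (yes _) (no _)  (yes _) _ = ℕ.≤-refl
      one-orientation (yes _) (yes a) (yes b) _       f = contradiction b (f a)

      -- Transposing one copy of the sum pairs `v ⟶ w` with `w ⟶ v`; at most one of them holds for
      -- each pair in S × S.
      inner+inner≤b² : ∑² inner ℕ.+ ∑² inner ℕ.≤ b ℕ.* b
      inner+inner≤b² = begin
        ∑² inner ℕ.+ ∑² inner                  ≡⟨ cong (∑² inner ℕ.+_) (∑-comm inner) ⟩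
        ∑² inner ℕ.+ ∑² (flip inner)           ≡⟨ ∑²-distrib-+ inner (flip inner) ⟨
        ∑² (λ v w → inner v w ℕ.+ inner w v)   ≤⟨ ∑²-mono (λ v w → one-orientation
          (backward? u v) (v ⟶? w) (w ⟶? v) (backward? u w) ⟶-asym) ⟩
        ∑² (λ v w → s v ℕ.* s w)               ≡⟨ ∑²-* s s ⟩
        b ℕ.* b                                ∎
        where open ℕ.≤-Reasoning

      backward-outdegrees : b ℕ.* d ℕ.≤ ∑² (λ v w → s v ℕ.* edge v w)
      backward-outdegrees = begin
        b ℕ.* d                                ≡⟨ *-distribʳ-sum d s ⟩
        -- The degree condition in `Backward` enters here.
        (∑[ v < n ] (s v ℕ.* d))               ≤⟨ sum-mono (λ v → 𝟙-*-mono-≤ (backward? u v) proj₂) ⟩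
        (∑[ v < n ] (s v ℕ.* outdegree v))     ≡⟨ sum-cong-≗ (λ v → *-distribˡ-sum (s v) (edge v)) ⟩
        ∑² (λ v w → s v ℕ.* edge v w)          ∎
        where
        open ℕ.≤-Reasoning

      -- The two terms b d have different origins: on the left a lower bound for the number of edges
      -- with tail in S, on the right the product of the sizes of S and N⁺(u). Keeping both avoids
      -- the subtraction d - b.
      counting : b ℕ.* d ℕ.+ b ℕ.* b ℕ.≤ ∑² cycles ℕ.+ ∑² inner ℕ.+ b ℕ.* d
      counting = begin
        b ℕ.* d ℕ.+ b ℕ.* b
          ≤⟨ ℕ.+-mono-≤ backward-outdegrees (ℕ.≤-reflexive (sym (∑²-* s s))) ⟩
        ∑² (λ v w → s v ℕ.* edge v w) ℕ.+ ∑² (λ v w → s v ℕ.* s w)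
          ≡⟨ ∑²-distrib-+ (λ v w → s v ℕ.* edge v w) (λ v w → s v ℕ.* s w) ⟨
        ∑² (λ v w → s v ℕ.* edge v w ℕ.+ s v ℕ.* s w)
          ≤⟨ ∑²-mono (λ v w → pointwise (backward? u v) (v ⟶? w) (w ⟶? u)
               (backward? u w) (u ⟶? w) proj₁ closes) ⟩
        ∑² (λ v w → cycles v w ℕ.+ inner v w ℕ.+ s v ℕ.* edge u w)
          ≡⟨ ∑²-distrib-+ (λ v w → cycles v w ℕ.+ inner v w) (λ v w → s v ℕ.* edge u w) ⟩
        ∑² (λ v w → cycles v w ℕ.+ inner v w) ℕ.+ ∑² (λ v w → s v ℕ.* edge u w)
          ≡⟨ cong₂ ℕ._+_ (∑²-distrib-+ cycles inner) (∑²-* s (edge u)) ⟩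
        ∑² cycles ℕ.+ ∑² inner ℕ.+ b ℕ.* d ∎
        where open ℕ.≤-Reasoning

      cycles≤cyclic : ∀ v w → cycles v w ℕ.≤ 𝟙 (cyclic? u v w)
      cycles≤cyclic v w =
        𝟙-*-≤ (backward? u v) λ (uv , _) → 𝟙-*-≤ (v ⟶? w) λ vw → 𝟙-≤ (w ⟶? u) λ wu →
          1≤𝟙 (cyclic? u v w) (uv , vw , wu)

  backdegree² : ∀ u → backdegree u ℕ.* backdegree u ℕ.≤
    2 ℕ.* ∑² (λ v w → 𝟙 (cyclic? u v w))
  backdegree² u = ℕ.≤-trans b²≤2K (ℕ.*-monoʳ-≤ 2 (∑²-mono (cycles≤cyclic u)))
    where
    open ℕ.≤-Reasoning
    open ℕ-Solver
    b² = b u ℕ.* b u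
    K  = ∑² (cycles u)
    P  = ∑² (inner u)

    b²≤K+P : b² ℕ.≤ K ℕ.+ P
    b²≤K+P = ℕ.+-cancelˡ-≤ (b u ℕ.* d u) b² (K ℕ.+ P)
      (subst (b u ℕ.* d u ℕ.+ b² ℕ.≤_) (ℕ.+-comm (K ℕ.+ P) (b u ℕ.* d u)) (counting u))

    -- Doubling b² ≤ K + P and using 2P ≤ b² gives 2b² ≤ 2K + b².
    b²≤2K : b² ℕ.≤ 2 ℕ.* K
    b²≤2K = ℕ.+-cancelʳ-≤ b² b² (2 ℕ.* K) (begin
      b² ℕ.+ b²                     ≤⟨ ℕ.+-mono-≤ b²≤K+P b²≤K+P ⟩
      (K ℕ.+ P) ℕ.+ (K ℕ.+ P)       ≡⟨ solve 2 (λ k p → (k :+ p) :+ (k :+ p) := con 2 :* k :+ (p :+ p)) refl K P ⟩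
      2 ℕ.* K ℕ.+ (P ℕ.+ P)         ≤⟨ ℕ.+-monoʳ-≤ (2 ℕ.* K) (inner+inner≤b² u) ⟩
      2 ℕ.* K ℕ.+ b²                ∎)

  -- The 12 is the factor 2 of `backdegree²` times the factor 6 of `∑-cyclic≤`.
  ∑-backdegree² : ∑[ u < n ] (backdegree u ℕ.* backdegree u) ℕ.≤ 12 ℕ.* directedTriangles T
  ∑-backdegree² = begin
    ∑[ u < n ] (backdegree u ℕ.* backdegree u)
      ≤⟨ sum-mono backdegree² ⟩
    ∑[ u < n ] (2 ℕ.* ∑² (λ v w → 𝟙 (cyclic? u v w)))
      ≡⟨ *-distribˡ-sum 2 (λ u → ∑² (λ v w → 𝟙 (cyclic? u v w))) ⟨
    2 ℕ.* ∑³ (λ u v w → 𝟙 (cyclic? u v w))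
      ≤⟨ ℕ.*-monoʳ-≤ 2 ∑-cyclic≤ ⟩
    2 ℕ.* (6 ℕ.* directedTriangles T)
      ≡⟨ ℕ.*-assoc 2 6 (directedTriangles T) ⟨
    12 ℕ.* directedTriangles T ∎
    where open ℕ.≤-Reasoning

  -- The transitive tournament by decreasing outdegree

  private
    key : Fin n → ℕ × Fin n
    key u = outdegree u , u

    -- Larger outdegrees come first. The vertex itself breaks ties and makes `key` injective, so the
    -- pulled-back order is total with respect to `_≡_`.
    _≺_ : Rel (Fin n) 0ℓ
    _≺_ = ×-Lex _≡_ ℕ._>_ Fin._<_ on key

    ≺-isStrictTotalOrder : IsStrictTotalOrder _≡_ _≺_
    ≺-isStrictTotalOrder = record
      { isStrictPartialOrder = record
        { isEquivalence = isEquivalence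
        ; irrefl        = λ { refl → Lex.irrefl (refl , refl) }
        ; trans         = Lex.trans
        ; <-resp-≈      = (λ { refl p → p }) , (λ { refl p → p })
        }
      ; compare = cmp
      }
      where
      module Lex = IsStrictTotalOrder
        (×-isStrictTotalOrder (Flip.isStrictTotalOrder ℕ.<-isStrictTotalOrder)
                              (Fin.<-isStrictTotalOrder {n}))
      cmp : ∀ u v → _
      cmp u v with Lex.compare (key u) (key v)
      ... | tri< u≺v ≢ ⊁       = tri< u≺v (λ { refl → ≢ (refl , refl) }) ⊁
      ... | tri≈ ⊀ (_ , u≡v) ⊁ = tri≈ ⊀ u≡v ⊁
      ... | tri> ⊀ ≢ v≺u       = tri> ⊀ (λ { refl → ≢ (refl , refl) }) v≺u

  byOutdegree : Tournament n
  byOutdegree = record { _⟶_ = _≺_ ; compare = IsStrictTotalOrder.compare ≺-isStrictTotalOrder }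

  byOutdegree-isTransitive : IsTransitive byOutdegree
  byOutdegree-isTransitive = _≺_ , ≺-isStrictTotalOrder , λ u≺v → u≺v

  -- If `v` precedes `u`, then `v` has at least the outdegree of `u`; hence every reversed edge
  -- `u ⟶ v` is backward.
  reversals≤∑-backdegree : reversals T byOutdegree ℕ.≤ sum backdegree
  reversals≤∑-backdegree = begin
    reversals T byOutdegree
      ≡⟨ length-filter (reversed? T byOutdegree) (cartesianProduct (allFin n) (allFin n)) ⟩
    List.sum (map (𝟙 ∘ reversed? T byOutdegree) (cartesianProduct (allFin n) (allFin n)))
      ≡⟨ sum-map-pairs (𝟙 ∘ reversed? T byOutdegree) ⟩
    ∑² (λ u v → 𝟙 (reversed? T byOutdegree (u , v)))
      ≤⟨ ∑²-mono (λ u v → 𝟙-≤ (reversed? T byOutdegree (u , v)) (1≤𝟙 (backward? u v) ∘ backward)) ⟩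
    sum backdegree ∎
    where
    open ℕ.≤-Reasoning
    backward : ∀ {u v} → Reversed T byOutdegree (u , v) → Backward u v
    backward (u⟶v , inj₁ d<)      = u⟶v , ℕ.<⇒≤ d<
    backward (u⟶v , inj₂ (d≡ , _)) = u⟶v , ℕ.≤-reflexive (sym d≡)

  reversals²≤ : reversals T byOutdegree ℕ.* reversals T byOutdegree ℕ.≤
    directedTriangles T ℕ.* (12 ℕ.* n)
  reversals²≤ = begin
    reversals T byOutdegree ℕ.* reversals T byOutdegree
      ≤⟨ ℕ.*-mono-≤ reversals≤∑-backdegree reversals≤∑-backdegree ⟩
    sum backdegree ℕ.* sum backdegree
      ≤⟨ cauchy-schwarz backdegree ⟩
    n ℕ.* ∑[ u < n ] (backdegree u ℕ.* backdegree u)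
      ≤⟨ ℕ.*-monoʳ-≤ n ∑-backdegree² ⟩
    n ℕ.* (12 ℕ.* directedTriangles T)
      ≡⟨ solve 2 (λ n t → n :* (con 12 :* t) := t :* (con 12 :* n)) refl n (directedTriangles T) ⟩
    directedTriangles T ℕ.* (12 ℕ.* n) ∎
    where
    open ℕ.≤-Reasoning
    open ℕ-Solver

-- Rational estimates

-- Every term of the constant sequence `fromℕ k` is `ι k` by definition.
ι : ℕ → ℚ
ι k = ℤ.+ k ℚ./ 1

private
  toℚᵘ-ι : ∀ k → ℚ.toℚᵘ (ι k) ℚᵘ.≃ ℚᵘ.mkℚᵘ (ℤ.+ k) 0
  toℚᵘ-ι k = ℚ.toℚᵘ-fromℚᵘ (ℚᵘ.mkℚᵘ (ℤ.+ k) 0)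

ι-mono-≤ : ∀ {j k} → j ℕ.≤ k → ι j ℚ.≤ ι k
ι-mono-≤ {j} {k} j≤k = ℚ.toℚᵘ-cancel-≤
  (ℚᵘ.≤-respˡ-≃ (ℚᵘ.≃-sym (toℚᵘ-ι j)) (ℚᵘ.≤-respʳ-≃ (ℚᵘ.≃-sym (toℚᵘ-ι k))
    (ℚᵘ.*≤* (ℤ.*-monoʳ-≤-nonNeg (ℤ.+ 1) (ℤ.+≤+ j≤k)))))

ι-* : ∀ j k → ι (j ℕ.* k) ≡ ι j ℚ.* ι k
ι-* j k = ℚ.toℚᵘ-injective (begin
  ℚ.toℚᵘ (ι (j ℕ.* k))                           ≈⟨ toℚᵘ-ι (j ℕ.* k) ⟩
  ℚᵘ.mkℚᵘ (ℤ.+ (j ℕ.* k)) 0                      ≡⟨ cong (λ i → ℚᵘ.mkℚᵘ i 0) (ℤ.pos-* j k) ⟩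
  ℚᵘ.mkℚᵘ (ℤ.+ j) 0 ℚᵘ.* ℚᵘ.mkℚᵘ (ℤ.+ k) 0       ≈⟨ ℚᵘ.*-cong (toℚᵘ-ι j) (toℚᵘ-ι k) ⟨
  ℚ.toℚᵘ (ι j) ℚᵘ.* ℚ.toℚᵘ (ι k)                 ≈⟨ ℚ.toℚᵘ-homo-* (ι j) (ι k) ⟨
  ℚ.toℚᵘ (ι j ℚ.* ι k)                           ∎)
  where open ℚᵘ.≃-Reasoning

0≤ι : ∀ k → 0ℚ ℚ.≤ ι k
0≤ι k = ι-mono-≤ {0} {k} ℕ.z≤n

square-mono-≤ : ∀ {p q} → 0ℚ ℚ.≤ p → p ℚ.≤ q → p ℚ.* p ℚ.≤ q ℚ.* q
square-mono-≤ {p} {q} 0≤p p≤q = ℚ.≤-trans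
  (ℚ.*-monoˡ-≤-nonNeg p {{ℚ.nonNegative 0≤p}} p≤q)
  (ℚ.*-monoʳ-≤-nonNeg q {{ℚ.nonNegative (ℚ.≤-trans 0≤p p≤q)}} p≤q)

-- η = δ / (2 r + 1 + δ), which is at most 1.
square-continuous : ∀ r δ → 0ℚ ℚ.≤ r → 0ℚ ℚ.< δ →
  ∃ λ η → 0ℚ ℚ.< η × (r ℚ.+ η) ℚ.* (r ℚ.+ η) ℚ.≤ r ℚ.* r ℚ.+ δ
square-continuous r δ 0≤r 0<δ = η , 0<η , (begin
  (r ℚ.+ η) ℚ.* (r ℚ.+ η)            ≡⟨ solve 2 (λ r η → (r :+ η) :* (r :+ η) := r :* r :+ η :* (r :+ r :+ η)) refl r η ⟩
  r ℚ.* r ℚ.+ η ℚ.* (r ℚ.+ r ℚ.+ η)  ≤⟨ ℚ.+-monoʳ-≤ (r ℚ.* r) (ℚ.*-monoˡ-≤-nonNeg η {{ℚ.nonNegative (ℚ.<⇒≤ 0<η)}} 2r+η≤S) ⟩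
  r ℚ.* r ℚ.+ η ℚ.* S                ≡⟨ cong (r ℚ.* r ℚ.+_) η*S≡δ ⟩
  r ℚ.* r ℚ.+ δ                      ∎)
  where
  open ℚ.≤-Reasoning
  open ℚ-Solver
  0≤2r : 0ℚ ℚ.≤ r ℚ.+ r
  0≤2r = ℚ.+-mono-≤ 0≤r 0≤r
  1+δ = 1ℚ ℚ.+ δ
  S   = r ℚ.+ r ℚ.+ 1+δ
  δ>0 = ℚ.positive 0<δ
  S>0 : ℚ.Positive S
  S>0 = ℚ.nonNeg+pos⇒pos (r ℚ.+ r) {{ℚ.nonNegative 0≤2r}} 1+δ {{ℚ.pos+pos⇒pos 1ℚ δ {{δ>0}}}}
  S≢0 = ℚ.pos⇒nonZero S {{S>0}}
  1/S = ℚ.1/_ S {{S≢0}}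
  η   = δ ℚ.* 1/S

  0<η : 0ℚ ℚ.< η
  0<η = ℚ.positive⁻¹ η {{ℚ.pos*pos⇒pos δ {{δ>0}} 1/S {{ℚ.1/pos⇒pos S {{S>0}}}}}}

  η*S≡δ : η ℚ.* S ≡ δ
  η*S≡δ = trans (ℚ.*-assoc δ 1/S S)
    (trans (cong (δ ℚ.*_) (ℚ.*-inverseˡ S {{S≢0}})) (ℚ.*-identityʳ δ))

  δ≤S : δ ℚ.≤ S
  δ≤S = begin
    δ                    ≡⟨ trans (ℚ.+-identityˡ (0ℚ ℚ.+ δ)) (ℚ.+-identityˡ δ) ⟨
    0ℚ ℚ.+ (0ℚ ℚ.+ δ)    ≤⟨ ℚ.+-mono-≤ 0≤2r (ℚ.+-monoˡ-≤ δ (0≤ι 1)) ⟩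
    S                    ∎

  η≤1 : η ℚ.≤ 1ℚ
  η≤1 = ℚ.*-cancelʳ-≤-pos S {{S>0}}
    (subst₂ ℚ._≤_ (sym η*S≡δ) (sym (ℚ.*-identityˡ S)) δ≤S)

  2r+η≤S : r ℚ.+ r ℚ.+ η ℚ.≤ S
  2r+η≤S = ℚ.+-monoʳ-≤ (r ℚ.+ r) (begin
    η            ≤⟨ η≤1 ⟩
    1ℚ           ≡⟨ ℚ.+-identityʳ 1ℚ ⟨
    1ℚ ℚ.+ 0ℚ    ≤⟨ ℚ.+-monoʳ-≤ 1ℚ (ℚ.<⇒≤ 0<δ) ⟩
    1+δ          ∎)

1/12ℚ : ℚ
1/12ℚ = ℤ.+ 1 ℚ./ 12

clear-denominator : ∀ e n → 1/12ℚ ℚ.* (e ℚ.* e) ℚ.* ι (n ℕ.^ 3) ℚ.* ι (12 ℕ.* n) ≡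
  (e ℚ.* ι (n ℕ.^ 2)) ℚ.* (e ℚ.* ι (n ℕ.^ 2))
clear-denominator e n = begin
  1/12ℚ ℚ.* (e ℚ.* e) ℚ.* ι (n ℕ.^ 3) ℚ.* ι (12 ℕ.* n)
    ≡⟨ ℚ.*-assoc (1/12ℚ ℚ.* (e ℚ.* e)) (ι (n ℕ.^ 3)) (ι (12 ℕ.* n)) ⟩
  1/12ℚ ℚ.* (e ℚ.* e) ℚ.* (ι (n ℕ.^ 3) ℚ.* ι (12 ℕ.* n))
    ≡⟨ cong (1/12ℚ ℚ.* (e ℚ.* e) ℚ.*_) powers ⟩
  1/12ℚ ℚ.* (e ℚ.* e) ℚ.* (ι 12 ℚ.* (ι (n ℕ.^ 2) ℚ.* ι (n ℕ.^ 2)))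
    -- The product of `1/12ℚ` and `ι 12` evaluates to `1ℚ`.
    ≡⟨ regroup 1/12ℚ e (ι 12) (ι (n ℕ.^ 2)) ⟩
  1ℚ ℚ.* ((e ℚ.* ι (n ℕ.^ 2)) ℚ.* (e ℚ.* ι (n ℕ.^ 2)))
    ≡⟨ ℚ.*-identityˡ _ ⟩
  (e ℚ.* ι (n ℕ.^ 2)) ℚ.* (e ℚ.* ι (n ℕ.^ 2)) ∎
  where
  open ≡-Reasoning
  regroup : ∀ i e k m → i ℚ.* (e ℚ.* e) ℚ.* (k ℚ.* (m ℚ.* m)) ≡
    (i ℚ.* k) ℚ.* ((e ℚ.* m) ℚ.* (e ℚ.* m))
  regroup = solve 4 (λ i e k m → i :* (e :* e) :* (k :* (m :* m)) :=
    (i :* k) :* ((e :* m) :* (e :* m))) refl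
    where open ℚ-Solver

  powersℕ : ∀ n → n ℕ.^ 3 ℕ.* (12 ℕ.* n) ≡ 12 ℕ.* (n ℕ.^ 2 ℕ.* n ℕ.^ 2)
  powersℕ = solve 1 (λ n → n :^ 3 :* (con 12 :* n) := con 12 :* (n :^ 2 :* n :^ 2)) refl
    where open ℕ-Solver

  powers : ι (n ℕ.^ 3) ℚ.* ι (12 ℕ.* n) ≡ ι 12 ℚ.* (ι (n ℕ.^ 2) ℚ.* ι (n ℕ.^ 2))
  powers = begin
    ι (n ℕ.^ 3) ℚ.* ι (12 ℕ.* n)                ≡⟨ ι-* (n ℕ.^ 3) (12 ℕ.* n) ⟨
    ι (n ℕ.^ 3 ℕ.* (12 ℕ.* n))                  ≡⟨ cong ι (powersℕ n) ⟩
    ι (12 ℕ.* (n ℕ.^ 2 ℕ.* n ℕ.^ 2))            ≡⟨ ι-* 12 (n ℕ.^ 2 ℕ.* n ℕ.^ 2) ⟩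
    ι 12 ℚ.* ι (n ℕ.^ 2 ℕ.* n ℕ.^ 2)            ≡⟨ cong (ι 12 ℚ.*_) (ι-* (n ℕ.^ 2) (n ℕ.^ 2)) ⟩
    ι 12 ℚ.* (ι (n ℕ.^ 2) ℚ.* ι (n ℕ.^ 2))      ∎

-- For a single term `e` of the sequence of ε: multiplied by 12 n, the left side becomes (e n²)² ≤
-- (r + η)² ≤ r² + δ ≤ 12 n t + δ, and the positive factor 12 n is cancelled at the end.
estimate : ∀ n .{{_ : ℕ.NonZero n}} r t e δ η → 0ℚ ℚ.≤ e → 0ℚ ℚ.≤ δ →
  r ℕ.* r ℕ.≤ t ℕ.* (12 ℕ.* n) →
  (ι r ℚ.+ η) ℚ.* (ι r ℚ.+ η) ℚ.≤ ι r ℚ.* ι r ℚ.+ δ →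
  e ℚ.* ι (n ℕ.^ 2) ℚ.≤ ι r ℚ.+ η →
  1/12ℚ ℚ.* (e ℚ.* e) ℚ.* ι (n ℕ.^ 3) ℚ.≤ ι t ℚ.+ δ
estimate n@(ℕ.suc _) r t e δ η 0≤e 0≤δ r²≤ η-small e≤ =
  ℚ.*-cancelʳ-≤-pos (ι (12 ℕ.* n)) {{ℚ.normalize-pos (12 ℕ.* n) 1}} (begin
    1/12ℚ ℚ.* (e ℚ.* e) ℚ.* ι (n ℕ.^ 3) ℚ.* ι (12 ℕ.* n)
      ≡⟨ clear-denominator e n ⟩
    (e ℚ.* ι (n ℕ.^ 2)) ℚ.* (e ℚ.* ι (n ℕ.^ 2))
      ≤⟨ square-mono-≤ 0≤en² e≤ ⟩
    (ι r ℚ.+ η) ℚ.* (ι r ℚ.+ η)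
      ≤⟨ η-small ⟩
    ι r ℚ.* ι r ℚ.+ δ
      ≡⟨ cong₂ ℚ._+_ (ι-* r r) (ℚ.*-identityʳ δ) ⟨
    ι (r ℕ.* r) ℚ.+ δ ℚ.* 1ℚ
      -- Since 1 ≤ 12 n, the error δ is at most 12 n δ.
      ≤⟨ ℚ.+-mono-≤ (ι-mono-≤ r²≤)
           (ℚ.*-monoˡ-≤-nonNeg δ {{ℚ.nonNegative 0≤δ}} (ι-mono-≤ {1} {12 ℕ.* n} (ℕ.s≤s ℕ.z≤n))) ⟩
    ι (t ℕ.* (12 ℕ.* n)) ℚ.+ δ ℚ.* ι (12 ℕ.* n)
      ≡⟨ cong (ℚ._+ δ ℚ.* ι (12 ℕ.* n)) (ι-* t (12 ℕ.* n)) ⟩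
    ι t ℚ.* ι (12 ℕ.* n) ℚ.+ δ ℚ.* ι (12 ℕ.* n)
      ≡⟨ ℚ.*-distribʳ-+ (ι (12 ℕ.* n)) (ι t) δ ⟨
    (ι t ℚ.+ δ) ℚ.* ι (12 ℕ.* n) ∎)
  where
  open ℚ.≤-Reasoning
  0≤en² : 0ℚ ℚ.≤ e ℚ.* ι (n ℕ.^ 2)
  0≤en² = ℚ.nonNegative⁻¹ _ {{ℚ.nonNeg*nonNeg⇒nonNeg e {{ℚ.nonNegative 0≤e}}
    (ι (n ℕ.^ 2)) {{ℚ.nonNegative (0≤ι (n ℕ.^ 2))}}}}

-- Passage to real numbers

-- Supplies the sign that `estimate` needs for squaring: positivity of a real says nothing about its
-- early terms.
eventually-nonNeg : ∀ x → 0ℝ < x → ∃ λ N → ∀ k → N ℕ.≤ k → 0ℚ ℚ.≤ seq x k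
eventually-nonNeg x (δ , 0<δ , N , bound) = N , λ k N≤k →
  ℚ.≤-trans (ℚ.<⇒≤ 0<δ) (subst (ℚ._≤ seq x k) (ℚ.+-identityˡ δ) (bound k N≤k))

lemma1p3 : ∃ λ (c : ℝ) → 0ℝ < c ×
    (∀ (ε : ℝ) → 0ℝ < ε → ∀ (n : ℕ) → 0 ℕ.< n → ∀ (T : Tournament n) →
    FarFromTransitive ε T →
    fromℕ (directedTriangles T) ≥ c * (ε * ε) * fromℕ (n ℕ.^ 3))
-- With r ≥ ε n², the bound r² ≤ 12 n t yields t ≥ ε² n³ / 12. The gap witnessing 0 < c is 1/12
-- itself.
lemma1p3 = fromℚ 1/12ℚ , (1/12ℚ , ℚ.positive⁻¹ 1/12ℚ , 0 , λ _ _ → ℚ.≤-refl) , many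
  where
  many : ∀ (ε : ℝ) → 0ℝ < ε → ∀ (n : ℕ) → 0 ℕ.< n → ∀ (T : Tournament n) →
    FarFromTransitive ε T →
    fromℕ (directedTriangles T) ≥ fromℚ 1/12ℚ * (ε * ε) * fromℕ (n ℕ.^ 3)
  many ε 0<ε n 0<n T far δ 0<δ =
    let r = reversals T (byOutdegree T)
        -- Farness holds termwise only up to an error, so η is fixed first, small enough that
        -- squaring turns it into at most the allowed δ.
        η , 0<η , η-small = square-continuous (ι r) δ (0≤ι r) 0<δ
        N₁ , 0≤ε = eventually-nonNeg ε 0<ε
        N₂ , ε≤  = far (byOutdegree T) (byOutdegree-isTransitive T) η 0<η
    in N₁ ℕ.⊔ N₂ , λ k N≤k →
      estimate n {{ℕ.>-nonZero 0<n}} r (directedTriangles T) (seq ε k) δ η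
        (0≤ε k (ℕ.≤-trans (ℕ.m≤m⊔n N₁ N₂) N≤k)) (ℚ.<⇒≤ 0<δ) (reversals²≤ T) η-small
        (ε≤ k (ℕ.≤-trans (ℕ.m≤n⊔m N₁ N₂) N≤k))
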